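{- CbV contextual equivalence is consistent both in Plotkin's calculus $\lambda_{\mathsf{Plot}}$ and in the VSC; that is, neither $=_{\mathcal C}^{\lambda_{\mathsf{Plot}}}$ equates all terms of $\lambda_{\mathsf{Plot}}$, nor $=_{\mathcal C}^{\mathrm{VSC}}$ equates all terms of the VSC.
   Context: Value substitution calculus (VSC). Terms (the set $\Lambda_{\mathsf{vsc}}$) are $t,u,s ::= v \mid tu \mid t[x{\leftarrow}u]$ and values are $v ::= x \mid \lambda x.t$; $t[x{\leftarrow}u]$ is an explicit substitution (ES), binding $x$ in $t$. Terms are identified up to $\alpha$-renaming; $t\{x{\leftarrow}u\}$ is capture-avoiding (meta-level) substitution. Contexts are terms with exactly one hole $\langle\cdot\rangle$; plugging $C\langle t\rangle$ may capture variables. Substitution contexts: $L ::= \langle\cdot\rangle \mid L[x{\leftarrow}t]$. Root rules: $L\langle\lambda x.t\rangle u \mapsto_{\mathsf m} L\langle t[x{\leftarrow}u]\rangle$ and $t[x{\leftarrow}L\langle v\rangle] \mapsto_{\mathsf e} L\langle t\{x{\leftarrow}v\}\rangle$ with $v$ a value, where (by $\alpha$-renaming) $L$ captures no free variable of $u$, resp. of $t$. Full contexts: $F ::= \langle\cdot\rangle \mid Ft \mid tF \mid \lambda x.F \mid F[x{\leftarrow}t] \mid t[x{\leftarrow}F]$. The reduction $\to_{\mathsf{vsc}}$ is the closure of $\mapsto_{\mathsf m}\cup\mapsto_{\mathsf e}$ under full contexts. Plotkin's calculus $\lambda_{\mathsf{Plot}}$. Terms are those of the VSC without ES; reduction is the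 closure under all contexts (without ES) of $(\lambda x.t)v \mapsto t\{x{\leftarrow}v\}$ with $v$ a value (variable or abstraction). Contextual equivalence. For $\mathsf X \in\{\lambda_{\mathsf{Plot}},\mathrm{VSC}\}$ and terms $t,u$ of $\mathsf X$, $t =_{\mathcal C}^{\mathsf X} u$ iff for every context $C$ of $\mathsf X$ such that $C\langle t\rangle$ and $C\langle u\rangle$ are closed: $C\langle t\rangle \to_{\mathsf X}^* v$ for some value $v$ of $\mathsf X$ if and only if $C\langle u\rangle\to_{\mathsf X}^* v'$ for some value $v'$ of $\mathsf X$. -}

module Defs where

open import Data.List using (List; []; _∷_; _++_; [_]; filter; concatMap; foldr)
open import Data.List.Membership.Propositional using (_∉_)
open import Data.List.Relation.Binary.Disjoint.Propositional using (Disjoint)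
open import Data.Nat using (ℕ; suc; _⊔_; _≟_)
open import Data.Product using (∃-syntax; _×_)
open import Data.Sum using (_⊎_)
open import Function.Base using (_∘_)
open import Function.Bundles using (_⇔_)
open import Relation.Binary.Construct.Closure.ReflexiveTransitive using (Star)
open import Relation.Binary.PropositionalEquality using (_≡_)
open import Relation.Nullary using (yes; no; ¬?)

infixl 7 _·_
infixl 8 _[_←_]
infixl 8 _⟦_←_⟧
infixr 6 ƛ_∙_
infixl 6 _∖_
infix 4 _=α_ _↦β_ _↦m_ _↦e_ _⟶_ _⟶*_ _=𝒞_

data Calculus : Set where
  plot vsc : Calculus

Var : Set
Var = ℕ

-- Raw named terms.  Plotkin's calculus is the fragment without explicit
-- substitutions, which are only available at the index vsc.
data Term : Calculus → Set where
  var    : ∀ {X} → Var → Term X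
  ƛ_∙_   : ∀ {X} → Var → Term X → Term X
  _·_    : ∀ {X} → Term X → Term X → Term X
  _[_←_] : Term vsc → Var → Term vsc → Term vsc

data Value {X : Calculus} : Term X → Set where
  var : ∀ x → Value (var x)
  lam : ∀ x t → Value (ƛ x ∙ t)

_∖_ : List Var → Var → List Var
xs ∖ x = filter (λ y → ¬? (y ≟ x)) xs

fv : ∀ {X} → Term X → List Var
fv (var x)       = [ x ]
fv (ƛ x ∙ t)     = fv t ∖ x
fv (t · u)       = fv t ++ fv u
fv (t [ x ← u ]) = (fv t ∖ x) ++ fv u

Closed : ∀ {X} → Term X → Set
Closed t = fv t ≡ []

fresh : List Var → Var
fresh xs = suc (foldr _⊔_ 0 xs)

_[_↦_] : ∀ {X} → (Var → Term X) → Var → Term X → (Var → Term X)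
(σ [ x ↦ u ]) y with y ≟ x
... | yes _ = u
... | no  _ = σ y

-- Capture-avoiding simultaneous substitution: every binder x over t is renamed
-- to a variable not free in σ y, for any y free in t and distinct from x.
binder : ∀ {X} → (Var → Term X) → Var → Term X → Var
binder σ x t = fresh (concatMap (fv ∘ σ) (fv t ∖ x))

sub : ∀ {X} → (Var → Term X) → Term X → Term X
sub σ (var x)       = σ x
sub σ (ƛ x ∙ t)     = let z = binder σ x t in ƛ z ∙ sub (σ [ x ↦ var z ]) t
sub σ (t · u)       = sub σ t · sub σ u
sub σ (t [ x ← u ]) = let z = binder σ x t in sub (σ [ x ↦ var z ]) t [ z ← sub σ u ]

_⟦_←_⟧ : ∀ {X} → Term X → Var → Term X → Term X
t ⟦ x ← u ⟧ = sub (var [ x ↦ u ]) t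

data _=α_ : ∀ {X} → Term X → Term X → Set where
  var : ∀ {X} x → var {X} x =α var x
  lam : ∀ {X} {x y} {t u : Term X} z →
        z ∉ fv (ƛ x ∙ t) → z ∉ fv (ƛ y ∙ u) →
        t ⟦ x ← var z ⟧ =α u ⟦ y ← var z ⟧ →
        ƛ x ∙ t =α ƛ y ∙ u
  app : ∀ {X} {t t′ u u′ : Term X} →
        t =α t′ → u =α u′ → t · u =α t′ · u′
  es  : ∀ {x y} {t t′ u u′ : Term vsc} z →
        z ∉ fv t ∖ x → z ∉ fv t′ ∖ y →
        t ⟦ x ← var z ⟧ =α t′ ⟦ y ← var z ⟧ →
        u =α u′ →
        t [ x ← u ] =α t′ [ y ← u′ ]

data Ctx : Calculus → Set where
  ⟨·⟩  : ∀ {X} → Ctx X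
  appˡ : ∀ {X} → Ctx X → Term X → Ctx X
  appʳ : ∀ {X} → Term X → Ctx X → Ctx X
  lam  : ∀ {X} → Var → Ctx X → Ctx X
  esˡ  : Ctx vsc → Var → Term vsc → Ctx vsc
  esʳ  : Term vsc → Var → Ctx vsc → Ctx vsc

-- Plugging is literal and may capture free variables of the plugged term.
_⟨_⟩ : ∀ {X} → Ctx X → Term X → Term X
⟨·⟩       ⟨ s ⟩ = s
appˡ C t  ⟨ s ⟩ = C ⟨ s ⟩ · t
appʳ t C  ⟨ s ⟩ = t · C ⟨ s ⟩
lam x C   ⟨ s ⟩ = ƛ x ∙ C ⟨ s ⟩
esˡ C x t ⟨ s ⟩ = C ⟨ s ⟩ [ x ← t ]
esʳ t x C ⟨ s ⟩ = t [ x ← C ⟨ s ⟩ ]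

data SubCtx : Set where
  ⟨·⟩    : SubCtx
  _[_←_] : SubCtx → Var → Term vsc → SubCtx

_⟨_⟩ₛ : SubCtx → Term vsc → Term vsc
⟨·⟩           ⟨ s ⟩ₛ = s
(L [ x ← t ]) ⟨ s ⟩ₛ = L ⟨ s ⟩ₛ [ x ← t ]

captured : SubCtx → List Var
captured ⟨·⟩           = []
captured (L [ x ← t ]) = x ∷ captured L

data _↦β_ : Term plot → Term plot → Set where
  βv : ∀ {x t v} → Value v → (ƛ x ∙ t) · v ↦β t ⟦ x ← v ⟧

data _↦m_ : Term vsc → Term vsc → Set where
  m : ∀ {x t u} L → Disjoint (captured L) (fv u) →
      L ⟨ ƛ x ∙ t ⟩ₛ · u ↦m L ⟨ t [ x ← u ] ⟩ₛ

data _↦e_ : Term vsc → Term vsc → Set where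
  e : ∀ {x t v} L → Value v → Disjoint (captured L) (fv t) →
      t [ x ← L ⟨ v ⟩ₛ ] ↦e L ⟨ t ⟦ x ← v ⟧ ⟩ₛ

Root : (X : Calculus) → Term X → Term X → Set
Root plot t u = t ↦β u
Root vsc  t u = t ↦m u ⊎ t ↦e u

data Step {X : Calculus} : Term X → Term X → Set where
  step : ∀ C {r s} → Root X r s → Step (C ⟨ r ⟩) (C ⟨ s ⟩)

-- Reduction of α-equivalence classes: representatives may be chosen freely on
-- both sides, which is what makes the side conditions of m and e harmless.
_⟶_ : ∀ {X} → Term X → Term X → Set
t ⟶ u = ∃[ t′ ] ∃[ u′ ] t =α t′ × Step t′ u′ × u′ =α u

_⟶*_ : ∀ {X} → Term X → Term X → Set
_⟶*_ = Star _⟶_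

Converges : ∀ {X} → Term X → Set
Converges t = ∃[ v ] Value v × t ⟶* v

_=𝒞_ : ∀ {X} → Term X → Term X → Set
_=𝒞_ {X} t u = (C : Ctx X) → Closed (C ⟨ t ⟩) → Closed (C ⟨ u ⟩) →
                Converges (C ⟨ t ⟩) ⇔ Converges (C ⟨ u ⟩)

{-# OPTIONS --safe #-}

-- The identity is a value, while Ω = δδ diverges: up to α its only reducts are
-- Ω itself and, in the VSC, the intermediate term (x x)[x←δ], whose only reduct
-- is again Ω.  The set of these terms is thus closed under reduction and
-- contains no value, so the empty context separates the identity from Ω.
module Submission where

open import Data.List.Membership.Propositional using (_∉_)
open import Data.List.Membership.Propositional.Properties using (∈-filter⁺)
open import Data.List.Relation.Binary.Subset.Propositional using (_⊆_)
open import Data.List.Relation.Binary.Subset.Propositional.Properties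
  using (filter⁺′; xs⊆xs++ys; xs⊆ys++xs)
open import Data.List.Relation.Unary.Any using (here)
open import Data.Nat using (_≟_)
open import Data.Product using (_×_; _,_)
open import Data.Sum using (inj₁; inj₂)
open import Function.Base using (_∘_; id)
open import Function.Bundles using (module Equivalence)
open import Relation.Binary.Construct.Closure.ReflexiveTransitive using (ε; _◅_)
open import Relation.Binary.PropositionalEquality using (_≡_; _≢_; refl; sym; cong₂; subst)
open import Relation.Nullary using (¬_; ¬?; yes; no; contradiction)
open import Defs

private
  variable
    X : Calculus
    x y z : Var
    r s t u : Term X

·-injectiveˡ : ∀ {t t′ u u′ : Term X} → t · u ≡ t′ · u′ → t ≡ t′
·-injectiveˡ refl = refl

·-injectiveʳ : ∀ {t t′ u u′ : Term X} → t · u ≡ t′ · u′ → u ≡ u′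
·-injectiveʳ refl = refl

∖-mono : ∀ {xs ys} x → xs ⊆ ys → xs ∖ x ⊆ ys ∖ x
∖-mono x = filter⁺′ x≢? x≢? id
  where x≢? = λ y → ¬? (y ≟ x)

update-same : ∀ (σ : Var → Term X) x u → (σ [ x ↦ u ]) x ≡ u
update-same σ x u with x ≟ x
... | yes _   = refl
... | no x≢x = contradiction refl x≢x

dup : Var → Term X
dup x = var x · var x

δ : Var → Term X
δ x = ƛ x ∙ dup x

dup-sub : ∀ x (u : Term X) → dup x ⟦ x ← u ⟧ ≡ u · u
dup-sub x u = cong₂ _·_ (update-same var x u) (update-same var x u)

-- The binder names are independent because α-conversion may rename each copy of `δ` on its own. At
-- `plot` only `app` remains.
data Loop : Term X → Set where
  app : ∀ x y → Loop {X} (δ x · δ y)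
  es  : ∀ x y → Loop (dup x [ x ← δ y ])

¬loop-value : Value t → ¬ Loop t
¬loop-value (var _)   ()
¬loop-value (lam _ _) ()

-- Since `z` is fresh, an occurrence of `z` in `t ⟦ y ← var z ⟧` can only come from `y`. This is
-- what recovers the body of a binder from an α-equivalence.
var-α⁻ : ∀ (t : Term X) → z ∉ fv t ∖ y → var z =α t ⟦ y ← var z ⟧ → t ≡ var y
var-α⁻ {y = y} (var a) z∉ p with a ≟ y | p
... | yes refl | _     = refl
... | no a≢y   | var _ = contradiction (∈-filter⁺ (λ x → ¬? (x ≟ y)) (here refl) a≢y) z∉

dup-α⁻ : ∀ (t : Term X) → z ∉ fv t ∖ y → dup z =α t ⟦ y ← var z ⟧ → t ≡ dup y
-- Deciding `a ≟ y` makes the substitution compute; either way it yields a variable, never an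
-- application.
dup-α⁻ {z = z} {y = y} (var a) z∉ p with a ≟ y | p
... | yes _ | ()
... | no _  | ()
dup-α⁻ {z = z} {y = y} (t₁ · t₂) z∉ (app p q) =
  cong₂ _·_ (var-α⁻ t₁ (z∉ ∘ ∖-mono y (xs⊆xs++ys (fv t₁) (fv t₂))) p)
            (var-α⁻ t₂ (z∉ ∘ ∖-mono y (xs⊆ys++xs (fv t₂) (fv t₁))) q)

dup-body-α⁻ : ∀ x y (t : Term X) → z ∉ fv t ∖ y →
              dup x ⟦ x ← var z ⟧ =α t ⟦ y ← var z ⟧ → t ≡ dup y
dup-body-α⁻ {z = z} x y t z∉ p =
  dup-α⁻ t z∉ (subst (_=α t ⟦ y ← var z ⟧) (dup-sub x (var z)) p)

-- α-equivalence preserves the outer shape, and each bound body is exactly `dup` of its new binder.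
loop-α : Loop t → t =α u → Loop u
loop-α (app x y) (app (lam {y = x′} {u = t} _ _ z∉ p) (lam {y = y′} {u = u} _ _ w∉ q))
  with refl ← dup-body-α⁻ x x′ t z∉ p | refl ← dup-body-α⁻ y y′ u w∉ q = app x′ y′
loop-α (es x y) (es {y = x′} {t′ = t} _ _ z∉ p (lam {y = y′} {u = u} _ _ w∉ q))
  with refl ← dup-body-α⁻ x x′ t z∉ p | refl ← dup-body-α⁻ y y′ u w∉ q = es x′ y′

¬root-var : ∀ X {s} → ¬ Root X (var x) s
¬root-var plot ()
¬root-var vsc (inj₁ ())
¬root-var vsc (inj₂ ())

¬root-lam : ∀ X {t s} → ¬ Root X (ƛ x ∙ t) s
¬root-lam plot ()
¬root-lam vsc (inj₁ ())
¬root-lam vsc (inj₂ ())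

-- A variable in operator position is never an abstraction under a substitution context. The
-- equation leaves `r` free, so that the rule and `L` can be split first.
¬root-dup : ∀ X {r s} → Root X r s → r ≢ dup x
¬root-dup plot (βv _) ()
¬root-dup vsc (inj₁ (m ⟨·⟩ _)) ()
¬root-dup vsc (inj₁ (m (_ [ _ ← _ ]) _)) ()
¬root-dup vsc (inj₂ (e _ _ _)) ()

var-normal : ∀ (C : Ctx X) → Root X r s → C ⟨ r ⟩ ≢ var x
var-normal {X} ⟨·⟩ ρ refl = ¬root-var X ρ

dup-normal : ∀ (C : Ctx X) → Root X r s → C ⟨ r ⟩ ≢ dup x
dup-normal {X} ⟨·⟩ ρ eq = ¬root-dup X ρ eq
dup-normal (appˡ C t) ρ eq = var-normal C ρ (·-injectiveˡ eq)
dup-normal (appʳ t C) ρ eq = var-normal C ρ (·-injectiveʳ eq)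

δ-normal : ∀ (C : Ctx X) → Root X r s → C ⟨ r ⟩ ≢ δ x
δ-normal {X} ⟨·⟩ ρ refl = ¬root-lam X ρ
δ-normal {r = r} (lam x C) ρ eq with C ⟨ r ⟩ in eqC | eq
... | _ | refl = dup-normal C ρ eqC

-- The contracta lie in `Loop` literally, without renaming, as `dup x` contains no binder.
loop-root : ∀ X {r s} → Root X r s → Loop r → Loop s
loop-root plot (βv _) (app x y) = subst Loop (sym (dup-sub x (δ y))) (app y y)
loop-root vsc (inj₁ (m L _)) l = go L l
  where
  go : ∀ L → Loop (L ⟨ ƛ x ∙ t ⟩ₛ · u) → Loop (L ⟨ t [ x ← u ] ⟩ₛ)
  -- A nonempty `L` would make the operator an explicit substitution, but it is `δ x`.
  go ⟨·⟩ (app x y) = es x y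
loop-root vsc (inj₂ (e L _ _)) l = go L l
  where
  go : ∀ L → Loop (t [ x ← L ⟨ u ⟩ₛ ]) → Loop (L ⟨ t ⟦ x ← u ⟧ ⟩ₛ)
  -- Likewise `L` is empty, because the substituted term is the abstraction `δ y`.
  go ⟨·⟩ (es x y) = subst Loop (sym (dup-sub x (δ y))) (app y y)

-- The redex must be the whole term: any other hole lies within a copy of `δ` or within `dup x`,
-- which are normal.
loop-plug : ∀ (C : Ctx X) → Root X r s → Loop (C ⟨ r ⟩) → Loop (C ⟨ s ⟩)
loop-plug {X} ⟨·⟩ ρ l = loop-root X ρ l
loop-plug {r = r} (appˡ C t) ρ l with C ⟨ r ⟩ in eqC | l
... | _ | app _ _ = contradiction eqC (δ-normal C ρ)
loop-plug {r = r} (appʳ t C) ρ l with C ⟨ r ⟩ in eqC | l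
... | _ | app _ _ = contradiction eqC (δ-normal C ρ)
loop-plug {r = r} (esˡ C x t) ρ l with C ⟨ r ⟩ in eqC | l
... | _ | es _ _ = contradiction eqC (dup-normal C ρ)
loop-plug {r = r} (esʳ t x C) ρ l with C ⟨ r ⟩ in eqC | l
... | _ | es _ _ = contradiction eqC (δ-normal C ρ)

loop-⟶ : Loop t → t ⟶ u → Loop u
loop-⟶ l (_ , _ , p , step C ρ , q) = loop-α (loop-plug C ρ (loop-α l p)) q

loop-⟶* : Loop t → t ⟶* u → Loop u
loop-⟶* l ε        = l
loop-⟶* l (p ◅ ps) = loop-⟶* (loop-⟶ l p) ps

loop-diverges : Loop t → ¬ Converges t
loop-diverges l (_ , v , ps) = ¬loop-value v (loop-⟶* l ps)

=𝒞-consistent : ¬ ((t u : Term X) → t =𝒞 u)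
-- The identity converges in zero steps, so the forward implication would make Ω converge.
=𝒞-consistent all = loop-diverges (app 0 0) (Equivalence.to I⇔Ω (_ , lam 0 (var 0) , ε))
  where
  I⇔Ω = all (ƛ 0 ∙ var 0) (δ 0 · δ 0) ⟨·⟩ refl refl

proposition6p1 : (¬ ((t u : Term plot) → t =𝒞 u)) × (¬ ((t u : Term vsc) → t =𝒞 u))
proposition6p1 = =𝒞-consistent , =𝒞-consistent
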